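{- Memoryless strategies are sufficient to win one-player average-energy games. That is, let $G=(S_1,S_2,E,w)$ be a game with $S_1=\emptyset$ or $S_2=\emptyset$, let $s_{\mathrm{init}}\in S$ and $t\in\mathbb{Q}$. If the unique player (the player owning all the states) has a winning strategy from $s_{\mathrm{init}}$ for the objective $\mathsf{AvgEnergy}(t)$ (when this player is player 1), respectively against that objective (when this player is player 2), then this player has such a winning strategy that is memoryless.
   Context: A game is a tuple $G=(S_1,S_2,E,w)$ where $S_1,S_2$ are disjoint finite sets of states belonging to player 1 and player 2, $S=S_1\uplus S_2$, $E\subseteq S\times S$ is a finite set of edges such that every state has at least one outgoing edge, and $w\colon E\to\mathbb{Z}$ is an integer weight function. $G$ is one-player if $S_1=\emptyset$ or $S_2=\emptyset$. A play from $s_{\mathrm{init}}$ is an infinite sequence $\pi=s_0s_1s_2\dots$ with $s_0=s_{\mathrm{init}}$ and $(s_i,s_{i+1})\in E$ for all $i\ge 0$; $\pi(n)=s_0\dots s_n$ is its prefix up to position $n$. A strategy for player $i$ is a function $\sigma_i$ mapping each finite prefix ending in a state of $S_i$ to a successor (along an edge) of its last state; it is memoryless if it depends only on the last state. Strategies $\sigma_1,\sigma_2$ of the two players and the state $s_{\mathrm{init}}$ determine a unique play, the outcome. The energy level is $\mathrm{EL}(\pi(n))=\sum_{i=0}^{n-1}w(s_i,s_{i+1})$, and the average-energy of $\pi$ is $\overline{AE}(\pi)=\limsup_{n\to\infty}\frac1n\sum_{i=1}^{n}\mathrm{EL}(\pi(i))$. For $t\in\mathbb{Q}$, $\mathsf{AvgEnergy}(t)$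 is the set of plays $\pi$ with $\overline{AE}(\pi)\le t$. A strategy $\sigma_1$ of player 1 is winning from $s_{\mathrm{init}}$ for an objective (set of plays) $\mathcal W$ if, for every strategy of player 2, the outcome lies in $\mathcal W$; a strategy of player 2 is winning (against $\mathcal W$) if, for every strategy of player 1, the outcome does not lie in $\mathcal W$. -}

module Defs where

open import Data.Bool.Base using (Bool; T)
open import Data.Fin.Base using (Fin)
open import Data.Integer.Base as ℤ using (ℤ; 0ℤ)
open import Data.Nat.Base as ℕ using (ℕ; zero; suc; NonZero)
open import Data.Product.Base using (Σ; ∃; _,_; proj₁; proj₂)
open import Data.Rational.Base as ℚ using (ℚ)
open import Data.Sum.Base using (_⊎_; inj₁; inj₂)
open import Level using (0ℓ)
open import Relation.Binary.PropositionalEquality.Core using (_≡_)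
open import Relation.Nullary.Negation.Core using (¬_)
open import Relation.Unary using (Pred)

∑< : ℕ → (ℕ → ℤ) → ℤ
∑< zero    f = 0ℤ
∑< (suc n) f = ∑< n f ℤ.+ f n

-- limsup x = inf_N sup_{n ≥ N} x n, taken in the extended reals, is at most t
-- iff every rational q > t bounds some tail of x from above.
-- Sequences are indexed by n ≥ 1.
LimSup≤ : ((n : ℕ) → .{{NonZero n}} → ℚ) → ℚ → Set
LimSup≤ x t =
  ∀ q → t ℚ.< q → ∃ λ N → ∀ n → .{{_ : NonZero n}} → N ℕ.≤ n → x n ℚ.≤ q

-- Finite sets of states are taken to be Fin n₁ and Fin n₂, and E is given by
-- its characteristic function, so that edges are decidable and proof-irrelevant.
record Game : Set where
  field
    n₁ n₂ : ℕ

  S₁ : Set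
  S₁ = Fin n₁

  S₂ : Set
  S₂ = Fin n₂

  S : Set
  S = S₁ ⊎ S₂

  field
    E : S → S → Bool

  infix 4 _⟶_
  _⟶_ : S → S → Set
  s ⟶ s′ = T (E s s′)

  Successor : S → Set
  Successor s = ∃ λ s′ → s ⟶ s′

  field
    total : ∀ s → Successor s
    w     : ∀ {s s′} → s ⟶ s′ → ℤ

module _ (G : Game) where
  open Game G

  record Play : Set where
    field
      state : ℕ → S
      step  : ∀ i → state i ⟶ state (suc i)

  -- Indexed by the last state.  Since every state has a successor, the finite
  -- paths are exactly the finite prefixes of plays.
  data Prefix : S → Set where
    [_]  : ∀ s → Prefix s
    _∷ʳ_ : ∀ {s s′} → Prefix s → s ⟶ s′ → Prefix s′

  Strategy₁ Strategy₂ : Set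
  Strategy₁ = (s : S₁) → Prefix (inj₁ s) → Successor (inj₁ s)
  Strategy₂ = (s : S₂) → Prefix (inj₂ s) → Successor (inj₂ s)

  Memoryless₁ : Pred Strategy₁ 0ℓ
  Memoryless₁ σ₁ = ∀ s (h h′ : Prefix (inj₁ s)) → σ₁ s h ≡ σ₁ s h′

  Memoryless₂ : Pred Strategy₂ 0ℓ
  Memoryless₂ σ₂ = ∀ s (h h′ : Prefix (inj₂ s)) → σ₂ s h ≡ σ₂ s h′

  module _ (σ₁ : Strategy₁) (σ₂ : Strategy₂) where

    move : ∀ s → Prefix s → Successor s
    move (inj₁ s) = σ₁ s
    move (inj₂ s) = σ₂ s

    outcomePrefix : S → ℕ → Σ S Prefix
    outcomePrefix s₀ zero    = s₀ , [ s₀ ]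
    outcomePrefix s₀ (suc n) =
      let (s , h)  = outcomePrefix s₀ n
          (s′ , e) = move s h
      in s′ , h ∷ʳ e

    outcome : S → Play
    outcome s₀ = record
      { state = λ n → proj₁ (outcomePrefix s₀ n)
      ; step  = λ n → let (s , h) = outcomePrefix s₀ n in proj₂ (move s h)
      }

  energyLevel : Play → ℕ → ℤ
  energyLevel π n = ∑< n (λ i → w (Play.step π i))

  meanEnergy : Play → (n : ℕ) → .{{NonZero n}} → ℚ
  meanEnergy π n = ∑< n (λ i → energyLevel π (suc i)) ℚ./ n

  Objective : Set₁
  Objective = Pred Play 0ℓ

  AvgEnergy : ℚ → Objective
  AvgEnergy t π = LimSup≤ (meanEnergy π) t

  Winning₁ : Objective → S → Pred Strategy₁ 0ℓ
  Winning₁ W s₀ σ₁ = ∀ σ₂ → W (outcome σ₁ σ₂ s₀)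

  Winning₂ : Objective → S → Pred Strategy₂ 0ℓ
  Winning₂ W s₀ σ₂ = ∀ σ₁ → ¬ W (outcome σ₁ σ₂ s₀)

{-# OPTIONS --safe #-}
module Submission where

-- Let player 1 own all states, the other case being symmetric.  If a cycle of
-- negative weight is reachable, repeating it drives the average-energy to -∞.
-- Otherwise let φ(s) be the least energy level of a walk from s_init to s, so
-- that every edge (s, s′) has slack w(s, s′) + φ(s) - φ(s′) ≥ 0, and
-- EL(π(n)) = φ(sₙ) + Aₙ, where Aₙ is the slack accumulated so far.  A cycle of
-- edges without slack along which φ has mean at most t, reached along edges
-- without slack, has average-energy at most t.  If there is none, then
-- Bellman-Ford potentials bound the sum of φ along any play below by
-- n (t + ε) - M Aₙ - C.  As the slacks are integers bounded by a constant,
-- A₁ + … + Aₙ grows at least quadratically in Aₙ and so compensates M Aₙ;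
-- hence no play has average-energy at most t.

open import Data.Bool.Properties using (T?; T-irrelevant)
open import Data.Fin.Base as Fin using (Fin)
open import Data.Fin.Properties using (injective⇒≤; inj⇒≟; +↔⊎)
open import Data.Integer.Base as ℤ
  using (ℤ; +_; -[1+_]; 0ℤ; 1ℤ; _+_; _*_; _-_; -_; _≤_; _<_; +≤+)
open import Data.Integer.Properties as ℤ hiding (_≟_)
open import Data.Integer.Tactic.RingSolver using (solve-∀)
open import Data.Nat.Base as ℕ using (ℕ; zero; suc; NonZero; z≤n; s≤s)
import Data.Nat.Properties as ℕ
open import Data.Product.Base using (∃; ∃₂; _×_; _,_; proj₁; proj₂)
open import Data.Rational.Base as ℚ using (ℚ; ↥_; ↧_)
import Data.Rational.Properties as ℚ
import Data.Rational.Unnormalised.Base as ℚᵘ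
import Data.Rational.Unnormalised.Properties as ℚᵘ
open import Data.Sum.Base as Sum using (_⊎_; inj₁; inj₂)
open import Function.Base using (_∘_)
open import Function.Bundles using (_↔_; Inverse)
open import Function.Properties.Inverse using (Inverse⇒Injection; ↔-sym)
open import Relation.Binary.Definitions using (DecidableEquality)
open import Relation.Binary.PropositionalEquality
  using (_≡_; _≢_; refl; sym; trans; cong; cong₂; subst; subst₂)
open import Relation.Nullary using (¬_; Dec; yes; no)
open import Relation.Nullary.Decidable using (_×-dec_)
open import Relation.Nullary.Negation using (contradiction)
open import Defs

-- Integer inequalities and finite sums.

-- Linear and polynomial inequalities are proved by exhibiting the difference
-- of the two sides as a manifestly nonnegative expression.
difference : ∀ {x y} d → 0ℤ ≤ d → y - x ≡ d → x ≤ y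
difference _ 0≤d eq = 0≤i-j⇒j≤i (subst (0ℤ ≤_) (sym eq) 0≤d)

gap : ∀ {x y} → x ≤ y → 0ℤ ≤ y - x
gap = i≤j⇒0≤j-i

gap< : ∀ {x y} → x < y → 0ℤ ≤ y - (1ℤ + x)
gap< = gap ∘ i<j⇒suc[i]≤j

i<j⇒i-j≤-1 : ∀ {i j} → i < j → i - j ≤ - 1ℤ
i<j⇒i-j≤-1 {i} {j} i<j = difference _ (gap< i<j) (eq i j)
  where
  eq : ∀ i j → - 1ℤ - (i - j) ≡ j - (1ℤ + i)
  eq = solve-∀

infixl 6 _⊕_
infixl 7 _⊛_

_⊕_ : ∀ {x y} → 0ℤ ≤ x → 0ℤ ≤ y → 0ℤ ≤ x + y
_⊕_ = +-mono-≤

_⊛_ : ∀ {x y} → 0ℤ ≤ x → 0ℤ ≤ y → 0ℤ ≤ x * y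
_⊛_ {+ m} {+ n} _ _ = subst (0ℤ ≤_) (pos-* m n) (+≤+ z≤n)

0≤+ : ∀ {n} → 0ℤ ≤ + n
0≤+ = +≤+ z≤n

0≤i*i : ∀ i → 0ℤ ≤ i * i
0≤i*i (+ n)    = 0≤+ {n} ⊛ 0≤+ {n}
0≤i*i -[1+ n ] = +≤+ z≤n

i≤+∣i∣ : ∀ i → i ≤ + ℤ.∣ i ∣
i≤+∣i∣ (+ n)    = ≤-refl
i≤+∣i∣ -[1+ n ] = ℤ.-≤+

∑-cong : ∀ {f g} → (∀ i → f i ≡ g i) → ∀ n → ∑< n f ≡ ∑< n g
∑-cong f≡g zero    = refl
∑-cong f≡g (suc n) = cong₂ _+_ (∑-cong f≡g n) (f≡g n)

∑-mono-≤ : ∀ {f g} → (∀ i → f i ≤ g i) → ∀ n → ∑< n f ≤ ∑< n g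
∑-mono-≤ f≤g zero    = ≤-refl
∑-mono-≤ f≤g (suc n) = +-mono-≤ (∑-mono-≤ f≤g n) (f≤g n)

∑-+ : ∀ f g n → ∑< n (λ i → f i + g i) ≡ ∑< n f + ∑< n g
∑-+ f g zero    = refl
∑-+ f g (suc n) =
  trans (cong (_+ (f n + g n)) (∑-+ f g n)) (eq (∑< n f) (∑< n g) (f n) (g n))
  where
  eq : ∀ s t x y → (s + t) + (x + y) ≡ (s + x) + (t + y)
  eq = solve-∀

∑-neg : ∀ f n → ∑< n (λ i → - f i) ≡ - ∑< n f
∑-neg f zero    = refl
∑-neg f (suc n) = trans (cong (_+ - f n) (∑-neg f n)) (sym (neg-distrib-+ (∑< n f) (f n)))

∑-affine : ∀ a f c n → ∑< n (λ i → a * f i + c) ≡ a * ∑< n f + c * + n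
∑-affine a f c zero    = eq a c
  where
  eq : ∀ a c → 0ℤ ≡ a * 0ℤ + c * 0ℤ
  eq = solve-∀
∑-affine a f c (suc n) =
  trans (cong (_+ (a * f n + c)) (∑-affine a f c n)) (eq a c (∑< n f) (f n) (+ n))
  where
  eq : ∀ a c s x n → (a * s + c * n) + (a * x + c) ≡ a * (s + x) + c * (1ℤ + n)
  eq = solve-∀

telescope-≤ : ∀ (x : ℕ → ℤ) f → (∀ i → x (suc i) ≤ x i + f i) →
  ∀ n → x n ≤ x 0 + ∑< n f
telescope-≤ x f step zero    = ≤-reflexive (sym (+-identityʳ (x 0)))
telescope-≤ x f step (suc n) = ≤-trans (step n)
  (≤-trans (+-monoˡ-≤ (f n) (telescope-≤ x f step n))
    (≤-reflexive (+-assoc (x 0) (∑< n f) (f n))))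

telescope : ∀ (x : ℕ → ℤ) f → (∀ i → x (suc i) ≡ x i + f i) →
  ∀ n → x n ≡ x 0 + ∑< n f
telescope x f step zero    = sym (+-identityʳ (x 0))
telescope x f step (suc n) = trans (step n)
  (trans (cong (_+ f n) (telescope x f step n)) (+-assoc (x 0) (∑< n f) (f n)))

telescope-≥ : ∀ (x : ℕ → ℤ) f → (∀ i → x i + f i ≤ x (suc i)) →
  ∀ n → x 0 + ∑< n f ≤ x n
telescope-≥ x f step zero    = ≤-reflexive (+-identityʳ (x 0))
telescope-≥ x f step (suc n) = ≤-trans
  (≤-reflexive (sym (+-assoc (x 0) (∑< n f) (f n))))
  (≤-trans (+-monoˡ-≤ (f n) (telescope-≥ x f step n)) (step n))

-- ∑ (k - i) for i = 1 … n is a concave quadratic polynomial in n.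
∑-descending-bounded : ∀ k n → ∑< n (λ i → k - + suc i) ≤ k * k
∑-descending-bounded k n = *-cancelˡ-≤-pos _ _ (+ 2)
  (difference _ (0≤i*i k ⊕ 0≤i*i (k - + n) ⊕ 0≤+ {n})
    (trans (cong (λ s → + 2 * (k * k) - s) (closed n)) (eq k (+ n))))
  where
  step : ∀ k n → + 2 * k * n - n * (1ℤ + n) + + 2 * (k - (1ℤ + n)) ≡
    + 2 * k * (1ℤ + n) - (1ℤ + n) * (1ℤ + (1ℤ + n))
  step = solve-∀
  base : ∀ k → + 2 * 0ℤ ≡ + 2 * k * 0ℤ - 0ℤ * (1ℤ + 0ℤ)
  base = solve-∀
  closed : ∀ n → + 2 * ∑< n (λ i → k - + suc i) ≡ + 2 * k * + n - + n * (1ℤ + + n)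
  closed zero    = base k
  closed (suc n) = trans (*-distribˡ-+ (+ 2) (∑< n (λ i → k - + suc i)) (k - + suc n))
    (trans (cong (_+ + 2 * (k - + suc n)) (closed n)) (step k (+ n)))
  eq : ∀ k n → + 2 * (k * k) - (+ 2 * k * n - n * (1ℤ + n)) ≡
    k * k + (k - n) * (k - n) + n
  eq = solve-∀

-- A sequence that starts at 0 and increases by at most w at each step has
-- 2w ∑ aᵢ ≥ aₙ², so its sum dominates any multiple of its last term.
∑-dominates-last : ∀ (a : ℕ → ℤ) k m → a 0 ≡ 0ℤ →
  (∀ i → a i ≤ a (suc i)) → (∀ i → a (suc i) ≤ a i + + suc k) →
  ∀ n → m * a n ≤ ∑< n (a ∘ suc) + + suc k * m * m
∑-dominates-last a k m a0≡0 mono step n =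
  *-cancelˡ-≤-pos _ _ (+ 2 * w)
    (difference _ (quadratic n ⊕ 0≤i*i (a n - w * m) ⊕ 0≤i*i (w * m))
      (eq w m (a n) (∑< n (a ∘ suc))))
  where
  w = + suc k

  eq : ∀ w m x t → + 2 * w * (t + w * m * m) - + 2 * w * (m * x) ≡
    (+ 2 * w * t - x * x) + (x - w * m) * (x - w * m) + w * m * (w * m)
  eq = solve-∀

  base : ∀ w → 0ℤ ≡ + 2 * w * 0ℤ - 0ℤ * 0ℤ
  base = solve-∀

  -- When the last term passes from `x` to `y`, the expression grows by two terms, nonnegative
  -- because `0 ≤ y ≤ x + w`.
  inc : ∀ w t x y → + 2 * w * (t + y) - y * y ≡
    (+ 2 * w * t - x * x) + + 2 * (x + w - y) * y + (y - x) * (y - x)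
  inc = solve-∀

  nonneg : ∀ n → 0ℤ ≤ a n
  nonneg zero    = ≤-reflexive (sym a0≡0)
  nonneg (suc n) = ≤-trans (nonneg n) (mono n)

  quadratic : ∀ n → 0ℤ ≤ + 2 * w * ∑< n (a ∘ suc) - a n * a n
  quadratic zero    = ≤-reflexive
    (subst (λ z → 0ℤ ≡ + 2 * w * 0ℤ - z * z) (sym a0≡0) (base w))
  quadratic (suc n) = subst (0ℤ ≤_) (sym (inc w (∑< n (a ∘ suc)) (a n) (a (suc n))))
    (quadratic n ⊕ 0≤+ {2} ⊛ gap (step n) ⊛ nonneg (suc n) ⊕ 0≤i*i (a (suc n) - a n))

-- Finite sets: decidable equality, exhaustive search, bounds.

module Finite {S : Set} {N : ℕ} (fin : Fin N ↔ S) where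

  private
    module fin = Inverse fin

  _≟_ : DecidableEquality S
  _≟_ = inj⇒≟ (Inverse⇒Injection (↔-sym fin))

  toFin-injective : ∀ {x y} → fin.from x ≡ fin.from y → x ≡ y
  toFin-injective {x} {y} eq =
    trans (sym (fin.strictlyInverseˡ x)) (trans (cong fin.to eq) (fin.strictlyInverseˡ y))

  to-all : ∀ {ℓ} {P : S → Set ℓ} → (∀ i → P (fin.to i)) → ∀ x → P x
  to-all {P = P} p x = subst P (fin.strictlyInverseˡ x) (p (fin.from x))

  search : ∀ {A : Set} {B : S → Set} → (∀ x → A ⊎ B x) → A ⊎ (∀ x → B x)
  search {A} ab = Sum.[ inj₁ , inj₂ ∘ to-all ] (go (ab ∘ fin.to))
    where
    go : ∀ {n} {B : Fin n → Set} → (∀ i → A ⊎ B i) → A ⊎ (∀ i → B i)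
    go {zero}  ab = inj₂ λ ()
    go {suc n} ab with ab Fin.zero | go (ab ∘ Fin.suc)
    ... | inj₁ a | _      = inj₁ a
    ... | inj₂ _ | inj₁ a = inj₁ a
    ... | inj₂ b | inj₂ f = inj₂ λ { Fin.zero → b ; (Fin.suc i) → f i }

  bounded : (f : S → ℤ) → ∃ λ b → ∀ x → f x ≤ + b
  bounded f = let b , f≤b = go (f ∘ fin.to) in b , to-all f≤b
    where
    go : ∀ {n} (f : Fin n → ℤ) → ∃ λ b → ∀ i → f i ≤ + b
    go {zero}  f = 0 , λ ()
    go {suc n} f =
      let b , f≤b = go (f ∘ Fin.suc)
          c = ℤ.∣ f Fin.zero ∣
      in c ℕ.+ b , λ
        { Fin.zero    → ≤-trans (i≤+∣i∣ _) (+≤+ (ℕ.m≤m+n c b))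
        ; (Fin.suc i) → ≤-trans (f≤b i) (+≤+ (ℕ.m≤n+m b c)) }

  bounded₂ : (f : S → S → ℤ) → ∃ λ b → ∀ x y → f x y ≤ + b
  bounded₂ f =
    let b , f≤b = bounded (λ x → + proj₁ (bounded (f x)))
    in b , λ x y → ≤-trans (proj₂ (bounded (f x)) y) (f≤b x)

-- Minima of integer functions on possibly empty types.

-- Emptiness is a separate case because a vertex may have no walk of bounded length leading to it.
Min : {A : Set} → (A → ℤ) → Set
Min {A} f = ¬ A ⊎ ∃ λ a → ∀ b → f a ≤ f b

-- The two maps need not be inverse to each other: it is enough that neither raises the value.
Min-map : ∀ {A B} {f : A → ℤ} {g : B → ℤ} (to : A → B) (from : B → A) →
  (∀ a → g (to a) ≤ f a) → (∀ b → f (from b) ≤ g b) → Min f → Min g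
Min-map to from g≤f f≤g (inj₁ ¬a)      = inj₁ (¬a ∘ from)
Min-map to from g≤f f≤g (inj₂ (a , m)) =
  inj₂ (to a , λ b → ≤-trans (g≤f a) (≤-trans (m (from b)) (f≤g b)))

Min-⊎ : ∀ {A B} {f : A → ℤ} {g : B → ℤ} → Min f → Min g → Min Sum.[ f , g ]
Min-⊎ (inj₁ ¬a) (inj₁ ¬b) = inj₁ Sum.[ ¬a , ¬b ]
Min-⊎ (inj₁ ¬a) (inj₂ (b , m)) =
  inj₂ (inj₂ b , λ { (inj₁ a) → contradiction a ¬a ; (inj₂ b) → m b })
Min-⊎ (inj₂ (a , m)) (inj₁ ¬b) =
  inj₂ (inj₁ a , λ { (inj₁ a) → m a ; (inj₂ b) → contradiction b ¬b })
Min-⊎ {f = f} {g} (inj₂ (a , m)) (inj₂ (b , m′)) with ≤-total (f a) (g b)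
... | inj₁ fa≤gb =
  inj₂ (inj₁ a , λ { (inj₁ a) → m a ; (inj₂ b) → ≤-trans fa≤gb (m′ b) })
... | inj₂ gb≤fa =
  inj₂ (inj₂ b , λ { (inj₁ a) → ≤-trans gb≤fa (m a) ; (inj₂ b) → m′ b })

Min-+ : ∀ {A : Set} {f : A → ℤ} c → Min f → Min (λ a → f a + c)
Min-+ c (inj₁ ¬a)      = inj₁ ¬a
Min-+ c (inj₂ (a , m)) = inj₂ (a , λ b → +-monoˡ-≤ c (m b))

Min-const : ∀ {A : Set} {c} → Dec A → Min {A} (λ _ → c)
Min-const (yes a) = inj₂ (a , λ _ → ≤-refl)
Min-const (no ¬a) = inj₁ ¬a

Min-× : ∀ {A B : Set} {f : A → ℤ} → Dec B → Min f → Min {B × A} (f ∘ proj₂)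
Min-× (no ¬b) _              = inj₁ (¬b ∘ proj₁)
Min-× (yes b) (inj₁ ¬a)      = inj₁ (¬a ∘ proj₂)
Min-× (yes b) (inj₂ (a , m)) = inj₂ ((b , a) , m ∘ proj₂)

Min-Σ-Fin : ∀ {n} {A : Fin n → Set} {f : ∀ i → A i → ℤ} →
  (∀ i → Min (f i)) → Min {∃ A} (λ (i , a) → f i a)
Min-Σ-Fin {zero}  m = inj₁ λ ()
Min-Σ-Fin {suc n} m = Min-map
  Sum.[ (λ a → Fin.zero , a) , (λ (i , a) → Fin.suc i , a) ]
  (λ { (Fin.zero , a) → inj₁ a ; (Fin.suc i , a) → inj₂ (i , a) })
  (λ { (inj₁ _) → ≤-refl ; (inj₂ _) → ≤-refl })
  (λ { (Fin.zero , _) → ≤-refl ; (Fin.suc i , _) → ≤-refl })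
  (Min-⊎ (m Fin.zero) (Min-Σ-Fin (m ∘ Fin.suc)))

Min-Σ : ∀ {S : Set} {N} → Fin N ↔ S → {A : S → Set} {f : ∀ x → A x → ℤ} →
  (∀ x → Min (f x)) → Min {∃ A} (λ (x , a) → f x a)
Min-Σ fin {A} {f} m = Min-map
  (λ (i , a) → to i , a)
  (λ (x , a) → from x , subst A (sym (strictlyInverseˡ x)) a)
  (λ _ → ≤-refl)
  (λ (x , a) → ≤-reflexive (transport (strictlyInverseˡ x) a))
  (Min-Σ-Fin (m ∘ to))
  where
  open Inverse fin
  transport : ∀ {x y} (eq : y ≡ x) a → f y (subst A (sym eq) a) ≡ f x a
  transport refl a = refl

-- Walks in a finite graph, lassos and Bellman-Ford potentials.

iterate : {A : Set} → (A → A) → A → ℕ → A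
iterate f a zero    = a
iterate f a (suc n) = f (iterate f a n)

module Walks
  {S : Set} {N : ℕ} (fin : Fin N ↔ S) (s₀ : S)
  (_⇒_ : S → S → Set) (_⇒?_ : ∀ x y → Dec (x ⇒ y))
  where

  open Finite fin

  infixl 5 _▷_
  -- All walks start at `s₀`, so that an inhabitant of `Walk x` witnesses that `x` is reachable.
  data Walk : S → Set where
    []  : Walk s₀
    _▷_ : ∀ {x y} → Walk x → x ⇒ y → Walk y

  infix 4 _∈_ _∉_
  data _∈_ (x : S) : ∀ {y} → Walk y → Set where
    here  : ∀ {p : Walk x} → x ∈ p
    there : ∀ {y z} {p : Walk y} {e : y ⇒ z} → x ∈ p → x ∈ p ▷ e

  _∉_ : ∀ (x : S) {y} → Walk y → Set
  x ∉ p = ¬ x ∈ p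

  _∈?_ : ∀ x {y} (p : Walk y) → Dec (x ∈ p)
  x ∈? [] with x ≟ s₀
  ... | yes refl = yes here
  ... | no x≢s₀  = no λ { here → x≢s₀ refl }
  x ∈? (_▷_ {y = y} p e) with x ≟ y | x ∈? p
  ... | yes refl | _       = yes here
  ... | no _     | yes x∈p = yes (there x∈p)
  ... | no x≢y   | no x∉p  = no λ { here → x≢y refl ; (there x∈p) → x∉p x∈p }

  data Simple : ∀ {x} → Walk x → Set where
    []  : Simple []
    _▷_ : ∀ {x y} {p : Walk x} {e : x ⇒ y} → Simple p → y ∉ p → Simple (p ▷ e)

  length : ∀ {x} → Walk x → ℕ
  length []      = 0
  length (p ▷ _) = suc (length p)

  weight : (S → S → ℤ) → ∀ {x} → Walk x → ℤ
  weight u []                  = 0ℤ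
  weight u (_▷_ {x} {y} p _) = weight u p + u x y

  weight-affine : ∀ a u c {x} (p : Walk x) →
    weight (λ x y → a * u x y + c) p ≡ a * weight u p + c * + length p
  weight-affine a u c [] = eq a c
    where
    eq : ∀ a c → 0ℤ ≡ a * 0ℤ + c * 0ℤ
    eq = solve-∀
  weight-affine a u c (_▷_ {x} {y} p _) =
    trans (cong (_+ (a * u x y + c)) (weight-affine a u c p))
      (eq a c (weight u p) (u x y) (+ length p))
    where
    eq : ∀ a c s x n → (a * s + c * n) + (a * x + c) ≡ a * (s + x) + c * (1ℤ + n)
    eq = solve-∀

  vertex : ∀ {x} (p : Walk x) → Fin (suc (length p)) → S
  vertex {x} p       Fin.zero    = x
  vertex     (p ▷ _) (Fin.suc i) = vertex p i

  vertex-∈ : ∀ {x} (p : Walk x) i → vertex p i ∈ p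
  vertex-∈ p       Fin.zero    = here
  vertex-∈ (p ▷ _) (Fin.suc i) = there (vertex-∈ p i)

  vertex-injective : ∀ {x} {p : Walk x} → Simple p → ∀ i j →
    vertex p i ≡ vertex p j → i ≡ j
  vertex-injective         _           Fin.zero    Fin.zero    _  = refl
  vertex-injective {p = p ▷ _} (_ ▷ y∉p)   Fin.zero    (Fin.suc j) eq =
    contradiction (subst (_∈ p) (sym eq) (vertex-∈ p j)) y∉p
  vertex-injective {p = p ▷ _} (_ ▷ y∉p)   (Fin.suc i) Fin.zero    eq =
    contradiction (subst (_∈ p) eq (vertex-∈ p i)) y∉p
  vertex-injective         (simple ▷ _) (Fin.suc i) (Fin.suc j) eq =
    cong Fin.suc (vertex-injective simple i j eq)

  -- Pigeonhole: the vertices of a simple walk, one more than its edges, are distinct.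
  simple⇒short : ∀ {x} {p : Walk x} → Simple p → length p ℕ.< N
  simple⇒short simple =
    injective⇒≤ (λ {i} {j} → vertex-injective simple i j ∘ toFin-injective)

  -- The part of a walk up to the last visit of x; junk if x is not on it.
  prefix : ∀ {y} → Walk y → S → ∃ Walk
  prefix []                  x = s₀ , []
  prefix (_▷_ {y = y} p e) x with x ≟ y
  ... | yes _ = y , p ▷ e
  ... | no  _ = prefix p x

  upto : (S → S → ℤ) → ∀ {y} → Walk y → S → ℤ
  upto u p x = weight u (proj₂ (prefix p x))

  prefix-last : ∀ {y} (p : Walk y) → prefix p y ≡ (y , p)
  prefix-last []                  = refl
  prefix-last (_▷_ {y = y} p e) with y ≟ y
  ... | yes _  = refl
  ... | no y≢y = contradiction refl y≢y

  prefix-▷ : ∀ {y z} (p : Walk y) (e : y ⇒ z) {x} → x ≢ z → prefix (p ▷ e) x ≡ prefix p x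
  prefix-▷ {z = z} p e {x} x≢z with x ≟ z
  ... | yes x≡z = contradiction x≡z x≢z
  ... | no  _   = refl

  prefix-end : ∀ {x y} {p : Walk y} → x ∈ p → proj₁ (prefix p x) ≡ x
  prefix-end {p = p} here = cong proj₁ (prefix-last p)
  prefix-end {x} (there {z = z} x∈p) with x ≟ z
  ... | yes x≡z = sym x≡z
  ... | no  _   = prefix-end x∈p

  prefix-simple : ∀ {y} {p : Walk y} → Simple p → ∀ x → Simple (proj₂ (prefix p x))
  prefix-simple []                        x = []
  prefix-simple (_▷_ {y = y} simple y∉p) x with x ≟ y
  ... | yes _ = simple ▷ y∉p
  ... | no  _ = prefix-simple simple x

  prefix-length : ∀ {y} (p : Walk y) x → length (proj₂ (prefix p x)) ℕ.≤ length p
  prefix-length []                  x = ℕ.≤-refl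
  prefix-length (_▷_ {y = y} p e) x with x ≟ y
  ... | yes _ = ℕ.≤-refl
  ... | no  _ = ℕ.m≤n⇒m≤1+n (prefix-length p x)

  -- The successor of x on the walk closed by an edge to z.
  next : ∀ {y} → Walk y → S → S → S
  next []                  z x = z
  next (_▷_ {y = y} p e) z x with x ≟ y
  ... | yes _ = z
  ... | no  _ = next p y x

  -- A step either takes the closing edge or follows the walk. In the latter case `upto u` grows by
  -- the weight of the edge, for every weight function `u`.
  data Next {y} (p : Walk y) (z : S) : S → S → Set where
    closing : Next p z y z
    along   : ∀ {x x′} → x ⇒ x′ → x′ ∈ p →
      (∀ u → upto u p x′ ≡ upto u p x + u x x′) → Next p z x x′

  -- Induction on the walk: the closing edge of the shorter walk becomes the appended edge `e` of
  -- the longer one. By simplicity the new vertex is not on the shorter walk, so the prefixes up to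
  -- earlier vertices do not change.
  next-spec : ∀ {y} {p : Walk y} → Simple p → ∀ z {x} → x ∈ p → Next p z x (next p z x)
  next-spec []                        z here = closing
  next-spec {p = p ▷ e} (_▷_ {y = y} simple y∉p) z {x} x∈p with x ≟ y | x∈p
  ... | yes refl | _         = closing
  ... | no x≢y   | here      = contradiction refl x≢y
  ... | no x≢y   | there x∈p′ with next p y x | next-spec simple y x∈p′
  ... | _  | closing = along e here λ u →
    trans (cong (weight u ∘ proj₂) (prefix-last (p ▷ e)))
      (sym (cong (λ q → weight u (proj₂ q) + u x y)
        (trans (prefix-▷ p e x≢y) (prefix-last p))))
  ... | x′ | along f x′∈p eq = along f (there x′∈p) λ u →
    trans (cong (weight u ∘ proj₂) (prefix-▷ p e (λ { refl → y∉p x′∈p })))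
      (trans (eq u) (sym (cong (λ q → weight u (proj₂ q) + u x x′) (prefix-▷ p e x≢y))))

  -- A simple walk with an edge back to one of its vertices. Every vertex on it has a single
  -- successor, so a memoryless strategy can follow it.
  record Lasso : Set where
    field
      {last knot} : S
      walk        : Walk last
      simple      : Simple walk
      knot∈walk   : knot ∈ walk
      back        : last ⇒ knot

    cycleWeight : (S → S → ℤ) → ℤ
    cycleWeight u = weight u walk + u last knot - upto u walk knot

    cycleLength : ℕ
    cycleLength = suc (length walk) ℕ.∸ length (proj₂ (prefix walk knot))

    cycleLength≤N : cycleLength ℕ.≤ N
    cycleLength≤N = ℕ.≤-trans (ℕ.m∸n≤m _ (length (proj₂ (prefix walk knot)))) (simple⇒short simple)

    cycleLength>0 : 0 ℕ.< cycleLength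
    cycleLength>0 = ℕ.m<n⇒0<n∸m (s≤s (prefix-length walk knot))

    cycleWeight-affine : ∀ a u c →
      cycleWeight (λ x y → a * u x y + c) ≡ a * cycleWeight u + c * + cycleLength
    cycleWeight-affine a u c = trans
      (cong₂ (λ s t → s + (a * u last knot + c) - t)
        (weight-affine a u c walk) (weight-affine a u c (proj₂ (prefix walk knot))))
      (trans (eq a c (weight u walk) (u last knot) (upto u walk knot) (+ length walk) (+ l))
        (cong (λ n → a * cycleWeight u + c * n) lengths))
      where
      l = length (proj₂ (prefix walk knot))
      eq : ∀ a c s x t m l → (a * s + c * m) + (a * x + c) - (a * t + c * l) ≡
        a * (s + x - t) + c * (1ℤ + m - l)
      eq = solve-∀
      lengths : + suc (length walk) - + l ≡ + cycleLength
      lengths = trans (m-n≡m⊖n (suc (length walk)) l)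
        (⊖-≥ (ℕ.m≤n⇒m≤1+n (prefix-length walk knot)))

    successor : S → S
    successor = next walk knot

    orbit : ℕ → S
    orbit = iterate successor s₀

    s₀∈ : ∀ {x} (p : Walk x) → s₀ ∈ p
    s₀∈ []      = here
    s₀∈ (p ▷ _) = there (s₀∈ p)

    orbit-∈ : ∀ n → orbit n ∈ walk
    orbit-∈ zero    = s₀∈ walk
    orbit-∈ (suc n) with orbit n | orbit-∈ n
    ... | x | x∈ with successor x | next-spec simple knot x∈
    ... | _ | closing       = knot∈walk
    ... | _ | along _ x′∈ _ = x′∈

    orbit-⇒ : ∀ n → orbit n ⇒ orbit (suc n)
    orbit-⇒ n with orbit n | orbit-∈ n
    ... | x | x∈ with successor x | next-spec simple knot x∈
    ... | _ | closing     = back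
    ... | _ | along e _ _ = e

    -- The weight up to a vertex is a potential along the walk, and along the
    -- closing edge as well when the cycle is nonpositive.
    orbit-bounded : ∀ u → cycleWeight u ≤ 0ℤ →
      ∃ λ c → ∀ n → ∑< n (λ i → u (orbit i) (orbit (suc i))) ≤ c
    orbit-bounded u cycle≤0 = + b - h s₀ , λ n →
      difference _
        (gap (h≤b (orbit n)) ⊕ gap (telescope-≥ (h ∘ orbit) (λ i → u (orbit i) (orbit (suc i))) step n))
        (eq (+ b) (h s₀) (h (orbit n)) (∑< n (λ i → u (orbit i) (orbit (suc i)))))
      where
      h   = upto u walk
      b   = proj₁ (bounded h)
      h≤b = proj₂ (bounded h)

      eq : ∀ b h₀ hₙ s → b - h₀ - s ≡ (b - hₙ) + (hₙ - (h₀ + s))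
      eq = solve-∀

      step : ∀ i → h (orbit i) + u (orbit i) (orbit (suc i)) ≤ h (orbit (suc i))
      step i with orbit i | orbit-∈ i
      ... | x | x∈ with successor x | next-spec simple knot x∈
      ... | _ | closing      = i-j≤0⇒i≤j (subst (λ q → weight u (proj₂ q) + u last knot - h knot ≤ 0ℤ)
                                 (sym (prefix-last walk)) cycle≤0)
      ... | _ | along _ _ eq = ≤-reflexive (sym (eq u))

    -- With `L` the cycle length, the weight `L * u + γ` gives the cycle total weight
    -- `L * (cycleWeight u + γ) ≤ 0`, so `orbit-bounded` applies. The factor `L` keeps the mean
    -- integral.
    orbit-drift : ∀ u γ → cycleWeight u ≤ - γ →
      ∃ λ c → ∀ n →
        + cycleLength * ∑< n (λ i → u (orbit i) (orbit (suc i))) ≤ c - γ * + n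
    orbit-drift u γ cycle≤ = proj₁ bound , λ n →
      difference _
        (gap (≤-trans (≤-reflexive (sym (∑-affine l (λ i → u (orbit i) (orbit (suc i))) γ n)))
          (proj₂ bound n)))
        (eq (proj₁ bound) l (∑< n (λ i → u (orbit i) (orbit (suc i)))) γ (+ n))
      where
      l = + cycleLength
      bound = orbit-bounded (λ x y → l * u x y + γ)
        (≤-trans (≤-reflexive (cycleWeight-affine l u γ))
          (difference _ (0≤+ {cycleLength} ⊛ gap cycle≤) (eq′ l (cycleWeight u) γ)))
        where
        eq′ : ∀ l β γ → 0ℤ - (l * β + γ * l) ≡ l * (- γ - β)
        eq′ = solve-∀
      eq : ∀ c l s γ n → (c - γ * n) - l * s ≡ c - (l * s + γ * n)
      eq = solve-∀

  module _ (u : S → S → ℤ) where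

    NegativeLasso : Set
    NegativeLasso = ∃ λ (l : Lasso) → Lasso.cycleWeight l u ≤ - 1ℤ

    -- Whenever an edge closes a cycle, the cycle is either negative, which yields a lasso, or can
    -- be cut out without raising the weight.
    shorten : ∀ {x} (p : Walk x) →
      NegativeLasso ⊎ (∃ λ (q : Walk x) → Simple q × weight u q ≤ weight u p)
    shorten []      = inj₂ ([] , [] , ≤-refl)
    shorten (_▷_ {x} {y} p e) with shorten p
    ... | inj₁ l                  = inj₁ l
    ... | inj₂ (q , simple , q≤p) with y ∈? q
    ... | no y∉q  = inj₂ (q ▷ e , simple ▷ y∉q , +-monoˡ-≤ (u x y) q≤p)
    ... | yes y∈q with weight u q + u x y <? upto u q y
    ... | yes cycle<0 = inj₁ (record
      { walk = q ; simple = simple ; knot∈walk = y∈q ; back = e } , i<j⇒i-j≤-1 cycle<0)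
    ... | no cycle≮0 = inj₂ (cut (prefix-end y∈q) (prefix-simple simple y)
      (≤-trans (≮⇒≥ cycle≮0) (+-monoˡ-≤ (u x y) q≤p)))
      where
      cut : ∀ {z w} {r : Walk z} → z ≡ y → Simple r → weight u r ≤ w →
        ∃ λ (r : Walk y) → Simple r × weight u r ≤ w
      cut {r = r} refl simple r≤ = r , simple , r≤

    ShortWalk : ℕ → S → Set
    ShortWalk k x = ∃ λ (p : Walk x) → length p ℕ.< k

    -- The Bellman-Ford recursion: a walk with fewer than `suc k` edges is empty or extends one with
    -- fewer than `k` edges.
    lightest : ∀ k x → Min {ShortWalk k x} (weight u ∘ proj₁)
    lightest zero    x = inj₁ λ ()
    lightest (suc k) x = Min-map
      (λ { (inj₁ refl)                → [] , s≤s z≤n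
         ; (inj₂ (_ , e , p , short)) → p ▷ e , s≤s short })
      (λ { ([] , _)             → inj₁ refl
         ; (p ▷ e , s≤s short) → inj₂ (_ , e , p , short) })
      (λ { (inj₁ refl) → ≤-refl ; (inj₂ _) → ≤-refl })
      (λ { ([] , _) → ≤-refl ; (_ ▷ _ , s≤s _) → ≤-refl })
      (Min-⊎ {f = λ _ → 0ℤ} (Min-const (x ≟ s₀))
        (Min-Σ fin {f = λ y (_ , p , _) → weight u p + u y x} λ y →
          Min-× (y ⇒? x) (Min-+ (u y x) (lightest k y))))

    -- Distances from `s₀`. The triangle inequality is required only for edges leaving reachable
    -- vertices; values at unreachable vertices are arbitrary.
    record Potential : Set where
      field
        ψ        : S → ℤ
        ψ≤       : ∀ {x y} → Walk x → x ⇒ y → ψ y ≤ ψ x + u x y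
        ψ-source : ψ s₀ ≤ 0ℤ
        attained : ∀ {x} → Walk x → ∃ λ (p : Walk x) → weight u p ≡ ψ x

    -- A lightest walk with fewer than `N` edges, extended by an edge, is shortened to a simple
    -- walk, which again has fewer than `N` edges. If this never exposes a negative cycle, the least
    -- weights of such walks satisfy the triangle inequality.
    negativeLasso⊎potential : NegativeLasso ⊎ Potential
    negativeLasso⊎potential = Sum.map₂ potential (search λ x → search λ y → extend x y)
      where
      Extend : S → S → Set
      Extend x y = x ⇒ y → (p : ShortWalk N x) →
        ∃ λ (q : ShortWalk N y) → weight u (proj₁ q) ≤ weight u (proj₁ p) + u x y

      extend : ∀ x y → NegativeLasso ⊎ Extend x y
      extend x y with x ⇒? y | lightest N x
      ... | no ¬e | _       = inj₂ λ e → contradiction e ¬e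
      ... | yes e | inj₁ ¬p = inj₂ λ _ p → contradiction p ¬p
      ... | yes e | inj₂ ((p , _) , m) = Sum.map₂
        (λ (q , simple , q≤) _ p′ →
          (q , simple⇒short simple) , ≤-trans q≤ (+-monoˡ-≤ (u x y) (m p′)))
        (shorten (p ▷ e))

      potential : (∀ x y → Extend x y) → Potential
      potential ext = record
        { ψ = ψ
        ; ψ≤ = λ {x} {y} p e →
            let q , q≡ψ = ψ-attained (short p)
                r , r≤  = ext x y e q
            in ≤-trans (ψ-least r) (≤-trans r≤ (≤-reflexive (cong (_+ u x y) q≡ψ)))
        ; ψ-source = ψ-least ([] , simple⇒short [])
        ; attained = λ p → let (q , _) , q≡ψ = ψ-attained (short p) in q , q≡ψ
        }
        where
        ψ : S → ℤ
        ψ x with lightest N x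
        -- A default for unreachable vertices, about which `Potential` demands nothing.
        ... | inj₁ _             = 0ℤ
        ... | inj₂ ((p , _) , _) = weight u p

        ψ-least : ∀ {x} (p : ShortWalk N x) → ψ x ≤ weight u (proj₁ p)
        ψ-least {x} p with lightest N x
        ... | inj₁ ¬p      = contradiction p ¬p
        ... | inj₂ (_ , m) = m p

        ψ-attained : ∀ {x} → ShortWalk N x → ∃ λ (p : ShortWalk N x) → weight u (proj₁ p) ≡ ψ x
        ψ-attained {x} p with lightest N x
        ... | inj₁ ¬p      = contradiction p ¬p
        ... | inj₂ (q , _) = q , refl

        short : ∀ {x} → Walk x → ShortWalk N x
        short []      = [] , simple⇒short []
        short (_▷_ {x} {y} p e) = proj₁ (ext x y e (short p))

-- The dichotomy for a threshold: a lasso achieves it or all plays are bounded below.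

module Threshold
  {S : Set} {N : ℕ} (fin : Fin N ↔ S) (s₀ : S)
  (_⇒_ : S → S → Set) (_⇒?_ : ∀ x y → Dec (x ⇒ y)) (w : S → S → ℤ)
  (d : ℕ) (ρ κ : ℤ) (0≤κ : 0ℤ ≤ κ)
  where

  open Finite fin

  level total : (ℕ → S) → ℕ → ℤ
  level x n = ∑< n (λ i → w (x i) (x (suc i)))
  total x n = ∑< n (λ i → level x (suc i))

  D : ℤ
  D = + suc d

  -- `D * n` times the difference between the mean energy and the threshold.
  excess : (ℕ → S) → ℕ → ℤ
  excess x n = D * total x n + ρ * + n

  -- The threshold is -ρ / D.  For κ = 1 the dichotomy below separates a mean
  -- of at most the threshold from larger ones, for κ = 0 a mean strictly below
  -- the threshold from those at least equal to it.
  Achieved : Set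
  Achieved = ∃ λ f → (∀ n → iterate f s₀ n ⇒ iterate f s₀ (suc n)) ×
    ∃₂ λ k c → 0ℤ < k × (∀ n → k * excess (iterate f s₀) n ≤ c - (1ℤ - κ) * + n)

  Bounded : Set
  Bounded = ∃₂ λ k c → 0ℤ < k × (∀ x → x 0 ≡ s₀ → (∀ i → x i ⇒ x (suc i)) →
    ∀ n → κ * + n - c ≤ k * excess x n)

  private
    module W = Walks fin s₀ _⇒_ _⇒?_

  -- The levels on the orbit fall linearly, so the summands of the scaled excess are at most
  -- `K - i`, up to the term in `κ`, and their sum is at most `K * K`.
  descending⇒achieved : W.NegativeLasso w → Achieved
  descending⇒achieved (l , cycle≤-1) =
    successor , orbit-⇒ , L , K * K , ℤ.+<+ cycleLength>0 , λ n → ≤-trans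
      (≤-reflexive (trans (eq₁ L D (total orbit n) ρ (+ n))
        (sym (∑-affine (L * D) (λ i → level orbit (suc i)) (L * ρ) n))))
      (≤-trans (∑-mono-≤ {g = λ i → 1ℤ * (K - + suc i) + - (1ℤ - κ)} pointwise n)
        (≤-trans (≤-reflexive (∑-affine 1ℤ (λ i → K - + suc i) (- (1ℤ - κ)) n))
          (difference _ (gap (∑-descending-bounded K n))
            (eq₂ (K * K) κ (+ n) (∑< n (λ i → K - + suc i))))))
    where
    open W.Lasso l
    L = + cycleLength
    drift = orbit-drift w 1ℤ cycle≤-1
    c = proj₁ drift
    -- Chosen from `L * level ≤ c - n`: multiplying by `D ≥ 1` leaves at most `D * c - n`.
    K = D * c + L * ρ + (1ℤ - κ)

    eq₁ : ∀ L D T ρ n → L * (D * T + ρ * n) ≡ L * D * T + L * ρ * n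
    eq₁ = solve-∀
    eq₂ : ∀ q κ n s → q - (1ℤ - κ) * n - (1ℤ * s + - (1ℤ - κ) * n) ≡ q - s
    eq₂ = solve-∀
    eq₃ : ∀ L d ρ κ c e n →
      (1ℤ * ((1ℤ + d) * c + L * ρ + (1ℤ - κ) - n) + - (1ℤ - κ)) -
        (L * (1ℤ + d) * e + L * ρ) ≡
      (1ℤ + d) * (c - 1ℤ * n - L * e) + d * n
    eq₃ = solve-∀

    pointwise : ∀ i → L * D * level orbit (suc i) + L * ρ ≤
      1ℤ * (K - + suc i) + - (1ℤ - κ)
    pointwise i = difference _
      (0≤+ {suc d} ⊛ gap (proj₂ drift (suc i)) ⊕ 0≤+ {d} ⊛ 0≤+ {suc i})
      (eq₃ L (+ d) ρ κ c (level orbit (suc i)) (+ suc i))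

  module _ (potential : W.Potential w) where
    open W.Potential potential renaming (ψ to φ; ψ≤ to φ≤; ψ-source to φ-source)

    _⇛_ : S → S → Set
    x ⇛ y = x ⇒ y × φ x + w x y ≡ φ y

    _⇛?_ : ∀ x y → Dec (x ⇛ y)
    x ⇛? y = (x ⇒? y) ×-dec (φ x + w x y ℤ.≟ φ y)

    private
      module T = Walks fin s₀ _⇛_ _⇛?_

    φ≤weight : ∀ {x} (p : W.Walk x) → φ x ≤ W.weight w p
    φ≤weight W.[]                        = φ-source
    φ≤weight (W._▷_ {x} {y} p e) =
      ≤-trans (φ≤ p e) (+-monoˡ-≤ (w x y) (φ≤weight p))

    -- Every prefix weighs at least its `φ`, and an edge raises `φ` by at most its weight. Equality
    -- at the end therefore forces equality at every prefix, down to the empty one.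
    lightest⇒tight : ∀ {x} (p : W.Walk x) → W.weight w p ≡ φ x → φ s₀ ≡ 0ℤ × T.Walk x
    lightest⇒tight W.[]                 0≡φ  = sym 0≡φ , T.[]
    lightest⇒tight (W._▷_ {x} {y} p e) wp≡φ =
      let φ₀ , q = lightest⇒tight p wp≡φx
      in φ₀ , q T.▷ (e , trans (cong (_+ w x y) (sym wp≡φx)) wp≡φ)
      where
      eq : ∀ f s u → f - s ≡ f + u - (s + u)
      eq = solve-∀
      wp≡φx : W.weight w p ≡ φ x
      wp≡φx = ≤-antisym
        (difference _ (gap (≤-trans (≤-reflexive wp≡φ) (φ≤ p e)))
          (eq (φ x) (W.weight w p) (w x y)))
        (φ≤weight p)

    φ-source≡0 : φ s₀ ≡ 0ℤ
    φ-source≡0 = let p , wp≡φ = attained W.[] in proj₁ (lightest⇒tight p wp≡φ)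

    -- A lightest walk to a reachable vertex is tight. Hence potentials of the tight subgraph
    -- constrain every tight edge of an arbitrary play.
    tightWalk : ∀ {x} → W.Walk x → T.Walk x
    tightWalk p = let q , wq≡φ = attained p in proj₂ (lightest⇒tight q wq≡φ)

    -- `height` is the summand of `excess` when the level equals `φ`. It is charged to the target of
    -- the edge because levels are summed over positions `1` to `n`.
    height cost : S → S → ℤ
    height x y = D * φ y + ρ
    -- For κ = 1 the unit discount makes cycles of mean height 0 negative, the
    -- factor N making sure that no cycle of positive mean height becomes so.
    cost x y = + N * height x y + - κ

    -- On tight edges the level equals `φ`, so the excess is the sum of the heights and drifts with
    -- the height of the cycle.
    tightLasso⇒achieved : T.NegativeLasso cost → Achieved
    tightLasso⇒achieved (l , cycle≤-1) =
      successor , proj₁ ∘ orbit-⇒ , L , c , ℤ.+<+ cycleLength>0 , λ n →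
        subst (λ e → L * e ≤ c - (1ℤ - κ) * + n) (sym (excess≡ n)) (proj₂ drift n)
      where
      open T.Lasso l
      L = + cycleLength
      β = cycleWeight height

      eq : ∀ N β κ l → N * β + - κ * l ≡
        N * (β - (1ℤ + - (1ℤ - κ))) + κ * (N - l)
      eq = solve-∀

      cycle≤ : β ≤ - (1ℤ - κ)
      cycle≤ with β ≤? - (1ℤ - κ)
      ... | yes β≤ = β≤
      -- Here `β ≥ κ`, and `L ≤ N` gives `N * β - κ * L ≥ κ * (N - L) ≥ 0`.
      ... | no β≰  = contradiction
        (≤-trans (≤-reflexive (sym (cycleWeight-affine (+ N) height (- κ)))) cycle≤-1)
        (<⇒≱ (<-≤-trans ℤ.-<+ (subst (0ℤ ≤_) (sym (eq (+ N) β κ L))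
          (0≤+ {N} ⊛ gap< (≰⇒> β≰) ⊕ 0≤κ ⊛ gap (+≤+ cycleLength≤N)))))

      drift = orbit-drift height (1ℤ - κ) cycle≤
      c = proj₁ drift

      level≡φ : ∀ n → level orbit n ≡ φ (orbit n)
      level≡φ n = sym (trans
        (telescope (φ ∘ orbit) _ (λ i → sym (proj₂ (orbit-⇒ i))) n)
        (trans (cong (_+ level orbit n) φ-source≡0) (+-identityˡ _)))

      excess≡ : ∀ n → excess orbit n ≡ ∑< n (λ i → height (orbit i) (orbit (suc i)))
      excess≡ n = trans (sym (∑-affine D (λ i → level orbit (suc i)) ρ n))
        (∑-cong (λ i → cong (λ e → D * e + ρ) (level≡φ (suc i))) n)

    -- Violations of `ψ` on edges with slack add up to at most `E * M * a n`. By `∑-dominates-last`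
    -- the sum of the accumulated slacks absorbs this up to `E * K`.
    tightPotential⇒bounded : T.Potential cost → Bounded
    tightPotential⇒bounded tight =
      + N , ψ s₀ + + b + E * K , ℤ.+<+ N>0 , λ x x₀ steps n → let open Run x x₀ steps in
        difference _
          (gap (-ψ≤b (x n)) ⊕ 0≤E ⊛ gap (∑-dominates-last a W M a₀≡0 a-mono a-step n)
            ⊕ gap (costs n))
          (trans (cong (λ e → + N * e - (κ * + n - (ψ s₀ + + b + E * K))) (excess≡ n))
            (trans
              (eq (+ N) D κ (+ n) (ψ s₀) (ψ (x n)) (+ b) K M (∑< n (a ∘ suc)) (a n) (h n))
              (cong (λ s → + b - - ψ (x n) + E * (∑< n (a ∘ suc) + K - M * a n) +
                  (ψ s₀ + s - (ψ (x n) - E * M * a n)))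
                (sym (∑-affine (+ N) (λ i → height (x i) (x (suc i))) (- κ) n)))))
      where
      open T.Potential tight

      -- `E` is the factor of the summed slacks in `+ N * excess x n`, `W` bounds the slack of an
      -- edge, `m` bounds the violation of `ψ`, and `K` is the error term of `∑-dominates-last`.
      E = + N * D
      W = proj₁ (bounded₂ (λ x y → φ x + w x y - φ y))
      m = proj₁ (bounded₂ (λ x y → ψ y - ψ x - cost x y))
      M = + m
      K = + suc W * M * M
      b = proj₁ (bounded (λ x → - ψ x))
      -ψ≤b = proj₂ (bounded (λ x → - ψ x))

      N>0 : 0 ℕ.< N
      N>0 = W.simple⇒short W.[]

      0≤E : 0ℤ ≤ E
      0≤E = 0≤+ {N} ⊛ 0≤+ {suc d}

      1≤E : 1ℤ ≤ E
      1≤E = subst (1ℤ ≤_) (pos-* N (suc d)) (+≤+ (ℕ.*-mono-≤ N>0 (s≤s (z≤n {d}))))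

      eq : ∀ N D κ n ψ₀ ψₙ b K M T a h →
        N * (h + D * T) - (κ * n - (ψ₀ + b + N * D * K)) ≡
        b - - ψₙ + N * D * (T + K - M * a) + (ψ₀ + (N * h + - κ * n) - (ψₙ - N * D * M * a))
      eq = solve-∀

      module Run (x : ℕ → S) (x₀ : x 0 ≡ s₀) (steps : ∀ i → x i ⇒ x (suc i)) where

        -- `a` is the accumulated slack, and `h` is the part of the excess due to `φ`.
        a h : ℕ → ℤ
        a n = level x n - φ (x n)
        h n = ∑< n (λ i → height (x i) (x (suc i)))

        reach : ∀ n → W.Walk (x n)
        reach zero    = subst W.Walk (sym x₀) W.[]
        reach (suc n) = reach n W.▷ steps n

        slack : ℕ → ℤ
        slack i = φ (x i) + w (x i) (x (suc i)) - φ (x (suc i))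

        0≤slack : ∀ i → 0ℤ ≤ slack i
        0≤slack i = gap (φ≤ (reach i) (steps i))

        a-suc : ∀ i → a (suc i) ≡ a i + slack i
        a-suc i = eq₁ (level x i) (w (x i) (x (suc i))) (φ (x i)) (φ (x (suc i)))
          where
          eq₁ : ∀ l w f f′ → l + w - f′ ≡ l - f + (f + w - f′)
          eq₁ = solve-∀

        a₀≡0 : a 0 ≡ 0ℤ
        a₀≡0 = cong (λ z → 0ℤ - z) (trans (cong φ x₀) φ-source≡0)

        a-mono : ∀ i → a i ≤ a (suc i)
        a-mono i = difference _ (0≤slack i)
          (trans (cong (λ z → z - a i) (a-suc i)) (eq₁ (a i) (slack i)))
          where
          eq₁ : ∀ a s → a + s - a ≡ s
          eq₁ = solve-∀

        -- `suc W` replaces `W` because `∑-dominates-last` takes a positive bound on the increments.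
        a-step : ∀ i → a (suc i) ≤ a i + + suc W
        a-step i = ≤-trans (≤-reflexive (a-suc i)) (+-monoʳ-≤ (a i)
          (≤-trans (proj₂ (bounded₂ (λ x y → φ x + w x y - φ y)) (x i) (x (suc i)))
            (+≤+ (ℕ.n≤1+n W))))

        -- Tight edges respect the potential ψ; the others, having slack at
        -- least 1, violate it by a bounded multiple of their slack.
        ψ-step : ∀ i → ψ (x (suc i)) ≤
          ψ (x i) + (cost (x i) (x (suc i)) + E * M * slack i)
        ψ-step i with φ (x i) + w (x i) (x (suc i)) ℤ.≟ φ (x (suc i))
        ... | yes tight = ≤-trans (ψ≤ (tightWalk (reach i)) (steps i , tight))
          (+-monoʳ-≤ (ψ (x i)) (difference (E * M * slack i) (0≤E ⊛ 0≤+ {m} ⊛ 0≤slack i)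
            (eq₁ (cost (x i) (x (suc i))) (E * M * slack i))))
          where
          eq₁ : ∀ c s → c + s - c ≡ s
          eq₁ = solve-∀
        ... | no ¬tight = difference _
          (gap (proj₂ (bounded₂ (λ x y → ψ y - ψ x - cost x y)) (x i) (x (suc i)))
            ⊕ 0≤+ {m} ⊛ (gap 1≤E ⊛ 0≤slack i ⊕ gap 1≤slack))
          (eq₁ E M (slack i) (ψ (x i)) (ψ (x (suc i))) (cost (x i) (x (suc i))))
          where
          1≤slack : 1ℤ ≤ slack i
          1≤slack = i<j⇒suc[i]≤j (≤∧≢⇒< (0≤slack i)
            (λ 0≡ → ¬tight (i-j≡0⇒i≡j _ _ (sym 0≡))))
          eq₁ : ∀ E M s ψ ψ′ c → ψ + (c + E * M * s) - ψ′ ≡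
            M - (ψ′ - ψ - c) + M * ((E - 1ℤ) * s + (s - 1ℤ))
          eq₁ = solve-∀

        costs : ∀ n → ψ (x n) - E * M * a n ≤ ψ s₀ + ∑< n (λ i → cost (x i) (x (suc i)))
        costs n = subst (λ z → ψ (x n) - E * M * a n ≤ z + ∑< n (λ i → cost (x i) (x (suc i)))) start
          (telescope-≤ (λ i → ψ (x i) - E * M * a i) _ step n)
          where
          eq₁ : ∀ ψ z → ψ - z * 0ℤ ≡ ψ
          eq₁ = solve-∀
          eq₂ : ∀ z ψ ψ′ a s c →
            ψ - z * a + c - (ψ′ - z * (a + s)) ≡ ψ + (c + z * s) - ψ′
          eq₂ = solve-∀
          start : ψ (x 0) - E * M * a 0 ≡ ψ s₀
          start = trans (cong₂ (λ y z → ψ y - E * M * z) x₀ a₀≡0) (eq₁ (ψ s₀) (E * M))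
          step : ∀ i → ψ (x (suc i)) - E * M * a (suc i) ≤
            ψ (x i) - E * M * a i + cost (x i) (x (suc i))
          step i = difference _ (gap (ψ-step i))
            (trans (cong (λ z → ψ (x i) - E * M * a i + cost (x i) (x (suc i)) -
                (ψ (x (suc i)) - E * M * z)) (a-suc i))
              (eq₂ (E * M) (ψ (x i)) (ψ (x (suc i))) (a i) (slack i) (cost (x i) (x (suc i)))))

        excess≡ : ∀ n → excess x n ≡ h n + D * ∑< n (a ∘ suc)
        excess≡ n = trans (cong (λ s → D * s + ρ * + n) split)
          (trans (eq₁ D ρ (+ n) φs (∑< n (a ∘ suc)))
            (cong (_+ D * ∑< n (a ∘ suc)) (sym (∑-affine D (λ i → φ (x (suc i))) ρ n))))
          where
          φs = ∑< n (λ i → φ (x (suc i)))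
          eq₁ : ∀ D ρ n s t → D * (s + t) + ρ * n ≡ (D * s + ρ * n) + D * t
          eq₁ = solve-∀
          eq₂ : ∀ l f → l ≡ f + (l - f)
          eq₂ = solve-∀
          split : total x n ≡ φs + ∑< n (a ∘ suc)
          split = trans (∑-cong (λ i → eq₂ (level x (suc i)) (φ (x (suc i)))) n)
            (∑-+ (λ i → φ (x (suc i))) (a ∘ suc) n)

  achieved⊎bounded : Achieved ⊎ Bounded
  achieved⊎bounded with W.negativeLasso⊎potential w
  ... | inj₁ lasso = inj₁ (descending⇒achieved lasso)
  ... | inj₂ potential =
    Sum.map (tightLasso⇒achieved potential) (tightPotential⇒bounded potential)
      (Walks.negativeLasso⊎potential fin s₀ (_⇛_ potential) (_⇛?_ potential) (cost potential))

-- From integer bounds to the limit superior of rational means.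

-- Unnormalised rationals bypass the reduction to lowest terms in `i ℚ./ n`.
/-≤-intro : ∀ i n .{{_ : NonZero n}} q → i * ↧ q ≤ ↥ q * + n → i ℚ./ n ℚ.≤ q
/-≤-intro i n@(suc m) q@record{} h = ℚ.toℚᵘ-cancel-≤
  (ℚᵘ.≤-respˡ-≃ (ℚᵘ.≃-sym (ℚ.toℚᵘ-fromℚᵘ (ℚᵘ.mkℚᵘ i m))) (ℚᵘ.*≤* h))

/-≤-/-elim : ∀ i m j n .{{_ : NonZero m}} .{{_ : NonZero n}} →
  i ℚ./ m ℚ.≤ j ℚ./ n → i * + n ≤ j * + m
/-≤-/-elim i (suc m) j (suc n) h = ℚᵘ.drop-*≤*
  (ℚᵘ.≤-respˡ-≃ (ℚ.toℚᵘ-fromℚᵘ (ℚᵘ.mkℚᵘ i m))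
    (ℚᵘ.≤-respʳ-≃ (ℚ.toℚᵘ-fromℚᵘ (ℚᵘ.mkℚᵘ j n)) (ℚ.toℚᵘ-mono-≤ h)))

</-intro : ∀ q i n .{{_ : NonZero n}} → ↥ q * + n < i * ↧ q → q ℚ.< i ℚ./ n
</-intro q@record{} i (suc n) h = ℚ.toℚᵘ-cancel-<
  (ℚᵘ.<-respʳ-≃ (ℚᵘ.≃-sym (ℚ.toℚᵘ-fromℚᵘ (ℚᵘ.mkℚᵘ i n))) (ℚᵘ.*<* h))

module _ (s : ℕ → ℤ) (t : ℚ) {k : ℤ} (c : ℤ) where

  private
    p = ↥ t
    D = ↧ t

  LimSup≤-intro : 0ℤ < k → (∀ n → k * (D * s n + - p * + n) ≤ c) →
    LimSup≤ (λ n → s n ℚ./ n) t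
  LimSup≤-intro (ℤ.+<+ {n = suc k-1} _) bound q t<q =
    -- The mean is at most `t + c / (k D n)`, while `q - t ≥ 1 / (D b)` for the denominator `b` of
    -- `q`; so `n ≥ |c| b` suffices.
    ℤ.∣ c ∣ ℕ.* ℚ.denominatorℕ q , λ n N≤n → /-≤-intro (s n) n q
      (*-cancelˡ-≤-pos _ _ (k * D) (difference _
        (0≤+ {ℚ.denominatorℕ q} ⊛ gap (bound n)
          ⊕ 0≤+ {suc k-1} ⊛ 0≤+ {n} ⊛ gap< (ℚ.drop-*<* t<q)
          ⊕ (0≤+ {k-1} ⊛ 0≤+ {n} ⊕ gap (≤-trans (≤-reflexive (sym (pos-* ℤ.∣ c ∣ _))) (+≤+ N≤n))
            ⊕ 0≤+ {ℚ.denominatorℕ q} ⊛ gap (i≤+∣i∣ c)))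
        (eq (+ k-1) D (↥ q) (+ n) (s n) (↧ q) c p (+ ℤ.∣ c ∣))))
    where
    eq : ∀ k D a n s b c p |c| →
      (1ℤ + k) * D * (a * n) - (1ℤ + k) * D * (s * b) ≡
      b * (c - (1ℤ + k) * (D * s + - p * n)) +
      (1ℤ + k) * n * (a * D - (1ℤ + p * b)) +
      (k * n + (n - |c| * b) + b * (|c| - c))
    eq = solve-∀

  -- The mean stays above t + 1/(kD) - O(1/n), hence eventually above t + 1/(2kD).
  LimSup≤-elim : 0ℤ < k → (∀ n → + n - c ≤ k * (D * s n + - p * + n)) →
    ¬ LimSup≤ (λ n → s n ℚ./ n) t
  LimSup≤-elim (ℤ.+<+ {n = suc k-1} _) bound limsup = contradiction n≤2c (<⇒≱ 2c<n)
    where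
    δ = 2 ℕ.* (suc k-1 ℕ.* ℚ.denominatorℕ t)
    a = + 2 * k * p + 1ℤ
    t<a/δ : t ℚ.< a ℚ./ δ
    t<a/δ = </-intro t a δ (suc[i]≤j⇒i<j (difference _ (0≤+ {ℚ.denominator-1 t})
      (eq p k (+ ℚ.denominator-1 t))))
      where
      eq : ∀ p k d → (+ 2 * k * p + 1ℤ) * (1ℤ + d) - (1ℤ + p * (+ 2 * (k * (1ℤ + d)))) ≡ d
      eq = solve-∀
    eventually = limsup (a ℚ./ δ) t<a/δ
    n = suc (proj₁ eventually ℕ.+ 2 ℕ.* ℤ.∣ c ∣)
    n≤2c : + n ≤ + 2 * c
    n≤2c = difference _
      (gap (/-≤-/-elim (s n) n a δ
          (proj₂ eventually n (ℕ.m≤n⇒m≤1+n (ℕ.m≤m+n (proj₁ eventually) _))))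
        ⊕ 0≤+ {2} ⊛ gap (bound n))
      (eq (+ n) c k D (s n) p)
      where
      eq : ∀ n c k D s p → + 2 * c - n ≡
        (+ 2 * k * p + 1ℤ) * n - s * (+ 2 * (k * D)) +
        + 2 * (k * (D * s + - p * n) - (n - c))
      eq = solve-∀
    2c<n : + 2 * c < + n
    2c<n = ≤-<-trans (*-monoˡ-≤-nonNeg (+ 2) (i≤+∣i∣ c))
      (≤-<-trans (≤-reflexive (sym (pos-* 2 ℤ.∣ c ∣)))
        (ℤ.+<+ (s≤s (ℕ.m≤n+m _ (proj₁ eventually)))))

-- One-player games.

module OnePlayer (G : Game) (s-init : Game.S G) where
  open Game G

  finite : Fin (n₁ ℕ.+ n₂) ↔ S
  finite = +↔⊎

  _⟶?_ : ∀ x y → Dec (x ⟶ y)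
  x ⟶? y = T? (E x y)

  -- Walks take weights on all pairs of states; non-edges receive the default `0ℤ`.
  edgeWeight : S → S → ℤ
  edgeWeight x y with x ⟶? y
  ... | yes e = w e
  ... | no  _ = 0ℤ

  edgeWeight≡w : ∀ {x y} (e : x ⟶ y) → edgeWeight x y ≡ w e
  edgeWeight≡w {x} {y} e with x ⟶? y
  ... | yes e′ = cong w (T-irrelevant e′ e)
  ... | no ¬e  = contradiction e ¬e

  totalEnergy : Play G → ℕ → ℤ
  totalEnergy π n = ∑< n (λ i → energyLevel G π (suc i))

  -- A lasso prescribes edges only along its orbit, whereas a strategy must be defined everywhere;
  -- `total` supplies the remaining moves.
  choose : (S → S) → ∀ x → Successor x
  choose f x with x ⟶? f x
  ... | yes e = f x , e
  ... | no  _ = total x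

  choose-⟶ : ∀ f {x} → x ⟶ f x → proj₁ (choose f x) ≡ f x
  choose-⟶ f {x} e with x ⟶? f x
  ... | yes _ = refl
  ... | no ¬e = contradiction e ¬e

  outcome-iterate : ∀ f σ₁ σ₂ → (∀ x h → move G σ₁ σ₂ x h ≡ choose f x) →
    (∀ n → iterate f s-init n ⟶ iterate f s-init (suc n)) →
    ∀ n → Play.state (outcome G σ₁ σ₂ s-init) n ≡ iterate f s-init n
  outcome-iterate f σ₁ σ₂ follows edge zero    = refl
  outcome-iterate f σ₁ σ₂ follows edge (suc n)
    with outcomePrefix G σ₁ σ₂ s-init n | outcome-iterate f σ₁ σ₂ follows edge n
  ... | _ , h | refl = trans (cong proj₁ (follows _ h)) (choose-⟶ f (edge n))

  totalEnergy≡ : ∀ π (x : ℕ → S) → (∀ n → Play.state π n ≡ x n) → ∀ n →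
    totalEnergy π n ≡ ∑< n (λ i → ∑< (suc i) (λ j → edgeWeight (x j) (x (suc j))))
  totalEnergy≡ π x π≡x = ∑-cong λ i → ∑-cong
    (λ j → trans (sym (edgeWeight≡w (Play.step π j))) (cong₂ edgeWeight (π≡x j) (π≡x (suc j))))
    (suc i)

  neg-totalEnergy≡ : ∀ π (x : ℕ → S) → (∀ n → Play.state π n ≡ x n) → ∀ n →
    - totalEnergy π n ≡ ∑< n (λ i → ∑< (suc i) (λ j → - edgeWeight (x j) (x (suc j))))
  neg-totalEnergy≡ π x π≡x n = trans (cong -_ (totalEnergy≡ π x π≡x n))
    (trans (sym (∑-neg (λ i → ∑< (suc i) (edges x)) n))
      (∑-cong (λ i → sym (∑-neg (edges x) (suc i))) n))
    where
    edges : (ℕ → S) → ℕ → ℤ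
    edges x j = edgeWeight (x j) (x (suc j))

  module _ (t : ℚ) where

    private
      p = ↥ t
      D = ↧ t
      -- Player 1 needs a mean of at most `t = p / D`: the non-strict case `κ = 1`.
      module Minimise = Threshold finite s-init _⟶_ _⟶?_ edgeWeight
        (ℚ.denominator-1 t) (- p) 1ℤ (0≤+ {1})
      -- Player 2 needs a mean above `t`, that is, below `-p / D` after negating the weights: the
      -- strict case `κ = 0`.
      module Maximise = Threshold finite s-init _⟶_ _⟶?_ (λ x y → - edgeWeight x y)
        (ℚ.denominator-1 t) p 0ℤ ≤-refl

    memoryless₁ : n₂ ≡ 0 → ∃ (Winning₁ G (AvgEnergy G t) s-init) →
      ∃ λ σ₁ → Memoryless₁ G σ₁ × Winning₁ G (AvgEnergy G t) s-init σ₁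
    memoryless₁ n₂≡0 (σ₁ , σ₁-wins) with Minimise.achieved⊎bounded
    ... | inj₁ (f , edge , k , c , 0<k , bound) =
      (λ x _ → choose f (inj₁ x)) , (λ _ _ _ → refl) , λ σ₂ →
        let π = outcome G (λ x _ → choose f (inj₁ x)) σ₂ s-init
            π≡x = outcome-iterate f (λ x _ → choose f (inj₁ x)) σ₂
              (λ { (inj₁ _) _ → refl ; (inj₂ x) _ → contradiction (subst Fin n₂≡0 x) λ () }) edge
        in LimSup≤-intro (totalEnergy π) t c 0<k λ n →
          subst₂ (λ s b → k * (D * s + - p * + n) ≤ b)
            (sym (totalEnergy≡ π (iterate f s-init) π≡x n)) (eq c (+ n)) (bound n)
      where
      eq : ∀ c n → c - (1ℤ - 1ℤ) * n ≡ c
      eq = solve-∀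
    -- Every play from `s-init` now violates the objective, in particular an outcome of the given
    -- winning strategy.
    ... | inj₂ (k , c , 0<k , bound) = contradiction (σ₁-wins σ₂)
      (LimSup≤-elim (totalEnergy π) t c 0<k λ n →
        subst₂ (λ s b → b - c ≤ k * (D * s + - p * + n))
          (sym (totalEnergy≡ π (Play.state π) (λ _ → refl) n)) (*-identityˡ (+ n))
          (bound (Play.state π) refl (Play.step π) n))
      where
      σ₂ : Strategy₂ G
      σ₂ x _ = total (inj₂ x)
      π = outcome G σ₁ σ₂ s-init

    memoryless₂ : n₁ ≡ 0 → ∃ (Winning₂ G (AvgEnergy G t) s-init) →
      ∃ λ σ₂ → Memoryless₂ G σ₂ × Winning₂ G (AvgEnergy G t) s-init σ₂
    memoryless₂ n₁≡0 (σ₂ , σ₂-wins) with Maximise.achieved⊎bounded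
    ... | inj₁ (f , edge , k , c , 0<k , bound) =
      (λ x _ → choose f (inj₂ x)) , (λ _ _ _ → refl) , λ σ₁ →
        let π = outcome G σ₁ (λ x _ → choose f (inj₂ x)) s-init
            π≡x = outcome-iterate f σ₁ (λ x _ → choose f (inj₂ x))
              (λ { (inj₁ x) _ → contradiction (subst Fin n₁≡0 x) λ () ; (inj₂ _) _ → refl }) edge
        in LimSup≤-elim (totalEnergy π) t c 0<k λ n →
          difference _
            (gap (subst (λ s → k * (D * s + p * + n) ≤ c - (1ℤ - 0ℤ) * + n)
              (sym (neg-totalEnergy≡ π (iterate f s-init) π≡x n)) (bound n)))
            (eq c k D (totalEnergy π n) p (+ n))
      where
      eq : ∀ c k D s p n → k * (D * s + - p * n) - (n - c) ≡
        c - (1ℤ - 0ℤ) * n - k * (D * - s + p * n)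
      eq = solve-∀
    -- Every play from `s-init` now satisfies the objective, so the given strategy of player 2
    -- cannot be winning.
    ... | inj₂ (k , c , 0<k , bound) = contradiction
      (LimSup≤-intro (totalEnergy π) t c 0<k λ n →
        difference _
          (gap (subst (λ s → 0ℤ * + n - c ≤ k * (D * s + p * + n))
            (sym (neg-totalEnergy≡ π (Play.state π) (λ _ → refl) n))
            (bound (Play.state π) refl (Play.step π) n)))
          (eq c k D (totalEnergy π n) p (+ n)))
      (σ₂-wins σ₁)
      where
      σ₁ : Strategy₁ G
      σ₁ x _ = total (inj₁ x)
      π = outcome G σ₁ σ₂ s-init
      eq : ∀ c k D s p n → c - k * (D * s + - p * n) ≡
        k * (D * - s + p * n) - (0ℤ * n - c)
      eq = solve-∀

theorem3 : (G : Game) (s-init : Game.S G) (t : ℚ) →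
    (Game.n₂ G ≡ 0 →
    (∃ λ σ₁ → Winning₁ G (AvgEnergy G t) s-init σ₁) →
    (∃ λ σ₁ → Memoryless₁ G σ₁ × Winning₁ G (AvgEnergy G t) s-init σ₁))
    ×
    (Game.n₁ G ≡ 0 →
    (∃ λ σ₂ → Winning₂ G (AvgEnergy G t) s-init σ₂) →
    (∃ λ σ₂ → Memoryless₂ G σ₂ × Winning₂ G (AvgEnergy G t) s-init σ₂))
theorem3 G s-init t = memoryless₁ t , memoryless₂ t
  where open OnePlayer G s-init
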